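{- On HDAs over $\Sigma$, shp-bisimilarity is strictly contained in ST-bisimilarity: ${\underline{\leftrightarrow}_{shp}}\subsetneq{\underline{\leftrightarrow}_{ST}}$. In fact, even ${\underline{\leftrightarrow}_{shp}}\not\supseteq{\underline{\leftrightarrow}_{ureST}}$, i.e. there are HDAs that are ureST-bisimilar but not shp-bisimilar.
   Context: HDAs. $\Sigma$ is a fixed set of actions, containing pairwise distinct actions $a,b,c,d$. A conclist is $U=(n,\lambda)$ with $n\in\mathbb N$ and $\lambda:\{1<\dots<n\}\to\Sigma$. The category $\square$ has conclists as objects; a morphism $(m,\lambda)\to(n,\mu)$ is a pair $(f,\varepsilon)$ with $f:\{1,\dots,m\}\to\{1,\dots,n\}$ injective, order- and label-preserving, and $\varepsilon:\{1,\dots,n\}\to\{0,*,1\}$ with $\varepsilon^{ -1}(*)=\mathrm{im} f$; composition is $(g,\zeta)\circ(f,\varepsilon)=(g\circ f,\eta)$ with $\eta(g(t))=\varepsilon(t)$ and $\eta(u)=\zeta(u)$ for $u\notin\mathrm{im}\,g$. For $1\le i\le n$, $k\in\{0,1\}$, the coface map $d_i^k:U\to V$ ($V$ of dimension $n$, $U$ of dimension $n-1$) has $f$ omitting position $i$, $\varepsilon(i)=k$, and $\varepsilon(j)=*$ for $j\ne i$. A precubical set is a functor $X:\square^{op}\to\mathbf{Set}$; elements of $X[U]$, $U=(n,\lambda)$, are $n$-dimensional cells, and $\delta_i^k:=X[d_i^k]$. An HDA is a pair $(X,i)$ of a precubical set and an initial $0$-dimensional cell $i$. Paths. A path of an HDA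 $\mathcal X$ is a sequence $\alpha=(x_0,\varphi_1,x_1,\dots,\varphi_n,x_n)$ ($n\ge 0$) with $x_0$ the initial cell, $x_j\in X[U_j]$, where for each $j$ either $\varphi_j=d^0_{i_j}:U_{j-1}\to U_j$ with $x_{j-1}=\delta^0_{i_j}(x_j)$ (up-step, starting an event) or $\varphi_j=d^1_{i_j}:U_j\to U_{j-1}$ with $x_j=\delta^1_{i_j}(x_{j-1})$ (down-step, ending an event). $\alpha\hookrightarrow\alpha'$ means $\alpha$ is a prefix of $\alpha'$. $\alpha\leftrightarrows^\ell\beta$ ($\ell$-similarity): one of $\alpha,\beta$ is obtained from the other by replacing, around the cell $x_\ell$, $(d_i^0,x_\ell,d_j^0)$ by $(d_{j-1}^0,x'_\ell,d_i^0)$, or $(d_j^1,x_\ell,d_i^1)$ by $(d_i^1,x'_\ell,d_{j-1}^1)$, for some $i<j$ and some cell $x'_\ell$. $\alpha\sqsubseteq^\ell\beta$ ($\beta$ subsumes $\alpha$ at $\ell$): $\alpha$ is obtained from $\beta$ by replacing, around $x_\ell$, $(d_i^0,x_\ell,d_j^1)$ by $(d_{j-1}^1,x'_\ell,d_i^0)$, or $(d_j^0,x_\ell,d_i^1)$ by $(d_i^1,x'_\ell,d_{j-1}^0)$, for some $i<j$. ST-traces. Given a down-step at position $p$ of a path, move it to the left: as long as the step directly before it is a down-step, or an up-step whose index differs from the current index of the moving down-step, there is a unique replacement moving it one position left: for some $i<j$ and cells $x,x'$, it replaces $(d_j^1,x,d_i^1)$ by $(d_i^1,x',d_{j-1}^1)$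 or conversely (if the step directly before is a down-step), or it replaces $(d_i^0,x,d_j^1)$ by $(d_{j-1}^1,x',d_i^0)$ or $(d_j^0,x,d_i^1)$ by $(d_i^1,x',d_{j-1}^0)$ (if the step directly before is an up-step). This stops when the step directly before it, at position $k$, is an up-step with the same index; put $\mathrm{start}(p)=k$. $\mathsf{ST}(\alpha)$ is the sequence whose $j$-th entry is $a^+$ if $\varphi_j$ is an up-step starting an event labelled $a$ (the label of the $i_j$-th event of $U_j$), and $a^{\mathrm{start}(j)}$ if $\varphi_j$ is a down-step ending an event labelled $a$ (the label of the $i_j$-th event of $U_{j-1}$). $I$-bisimulations. For $I\subseteq\{\sqsubseteq,\sqsupseteq,\leftrightarrows,\hookleftarrow\}$, an $I$-bisimulation between HDAs $\mathcal Y,\mathcal Z$ is a relation $\mathfrak R$ between paths of $\mathcal Y$ and of $\mathcal Z$ satisfying the following clauses, each also with the roles of $\mathcal Y$ and $\mathcal Z$ exchanged: (1) the length-$0$ paths of $\mathcal Y$ and $\mathcal Z$ are related; (2) if $(\alpha,\beta)\in\mathfrak R$ then $\mathsf{ST}(\alpha)=\mathsf{ST}(\beta)$; (3) if $(\alpha,\beta)\in\mathfrak R$ and $\alpha\hookrightarrow\alpha'$, there is $\beta'$ with $\beta\hookrightarrow\beta'$ and $(\alpha',\beta')\in\mathfrak R$; and those of the following whose symbol lies in $I$: ($\sqsubseteq$) if $(\alpha,\beta)\in\mathfrak R$ and $\alpha\sqsubseteq^\ell\alpha'$, there is $\beta'$ with $\beta\sqsubseteq^\ell\beta'$, $(\alpha',\beta')\in\mathfrak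 R$; ($\sqsupseteq$) the same with $\alpha'\sqsubseteq^\ell\alpha$ and $\beta'\sqsubseteq^\ell\beta$; ($\leftrightarrows$) the same with $\alpha'\leftrightarrows^\ell\alpha$ and $\beta'\leftrightarrows^\ell\beta$; ($\hookleftarrow$) the same with $\alpha'\hookrightarrow\alpha$ and $\beta'\hookrightarrow\beta$. $\mathcal Y,\mathcal Z$ are $I$-bisimilar, $\mathcal Y\,\underline{\leftrightarrow}_I\,\mathcal Z$, if an $I$-bisimulation between them exists. Names: ST is $I=\emptyset$; shp is $I=\{\sqsubseteq\}$; ureST is $I=\{\sqsupseteq,\leftrightarrows,\hookleftarrow\}$. -}

module Defs where

open import Level using (0ℓ)
open import Data.Nat using (ℕ; suc; pred; _<_)
open import Data.Fin as Fin using (Fin; toℕ; punchIn; punchOut)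
open import Data.Fin.Properties
  using (_≟_; punchIn-injective; punchIn-mono-≤; punchIn-punchOut; punchInᵢ≢i)
open import Data.Vec using (Vec; []; _∷_; lookup; removeAt)
open import Data.List using (List; []; _∷ʳ_)
open import Data.Maybe using (Maybe; just; nothing)
open import Data.Product using (Σ; ∃; ∃₂; _×_; _,_; proj₁; proj₂)
open import Data.Sum using (_⊎_)
open import Function using (id; _∘_)
open import Function.Bundles using (_⇔_; mk⇔; Equivalence)
open import Function.Definitions using (Injective)
open import Relation.Binary using (_Preserves_⟶_)
open import Relation.Binary.PropositionalEquality
  using (_≡_; _≗_; refl; sym; trans; cong)
open import Relation.Nullary using (yes; no; contradiction)
open import Relation.Unary using (Pred; _∈_; ∅; ｛_｝; _∪_)

-- {0,*,1} is Sign: 0 and 1 are `just` an End, * is ✶.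

data End : Set where
  𝟎 𝟏 : End

Sign : Set
Sign = Maybe End

pattern ✶ = nothing

-- A conclist (n , λ).  The labelling is a vector rather than a function
-- on Fin n, so that pointwise equal labellings are the same conclist.

Conclist : Set → ℕ → Set
Conclist Act n = Vec Act n

record Hom {Act : Set} {m n : ℕ} (U : Conclist Act m) (V : Conclist Act n) : Set where
  field
    f           : Fin m → Fin n
    injective   : Injective _≡_ _≡_ f
    f-mono      : f Preserves Fin._≤_ ⟶ Fin._≤_
    f-label     : ∀ t → lookup V (f t) ≡ lookup U t
    ε           : Fin n → Sign
    ε⁻¹✶        : ∀ u → ε u ≡ ✶ ⇔ ∃ λ t → f t ≡ u

module _ {Act : Set} where

  infix  4 _≈_
  infixr 9 _⊚_

  -- Equality of morphisms; the proof components do not matter.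

  _≈_ : ∀ {m n} {U : Conclist Act m} {V : Conclist Act n} → Hom U V → Hom U V → Set
  φ ≈ ψ = (Hom.f φ ≗ Hom.f ψ) × (Hom.ε φ ≗ Hom.ε ψ)

  idHom : ∀ {n} {U : Conclist Act n} → Hom U U
  idHom = record
    { f         = id
    ; injective = id
    ; f-mono    = id
    ; f-label   = λ _ → refl
    ; ε         = λ _ → ✶
    ; ε⁻¹✶      = λ u → mk⇔ (λ _ → u , refl) (λ _ → refl)
    }

  _⊚_ : ∀ {l m n} {U : Conclist Act l} {V : Conclist Act m} {W : Conclist Act n} →
        Hom V W → Hom U V → Hom U W
  _⊚_ {l} {n = n} ψ φ = record
    { f         = Ψ.f ∘ Φ.f
    ; injective = Φ.injective ∘ Ψ.injective
    ; f-mono    = Ψ.f-mono ∘ Φ.f-mono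
    ; f-label   = λ t → trans (Ψ.f-label (Φ.f t)) (Φ.f-label t)
    ; ε         = λ u → η u (Ψ.ε u) refl
    ; ε⁻¹✶      = λ u → mk⇔ (to u (Ψ.ε u) refl) (from u (Ψ.ε u) refl)
    }
    where
    module Φ = Hom φ
    module Ψ = Hom ψ

    -- If ζ(u) = * then u = g(t) for a unique t, and η(u) = ε(t).
    preimage : ∀ u → Ψ.ε u ≡ ✶ → ∃ λ t → Ψ.f t ≡ u
    preimage u = Equivalence.to (Ψ.ε⁻¹✶ u)

    η : (u : Fin n) (s : Sign) → Ψ.ε u ≡ s → Sign
    η u ✶        e = Φ.ε (proj₁ (preimage u e))
    η u (just k) e = just k

    to : ∀ u s (e : Ψ.ε u ≡ s) → η u s e ≡ ✶ → ∃ λ (t : Fin l) → Ψ.f (Φ.f t) ≡ u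
    to u ✶ e h with Equivalence.to (Φ.ε⁻¹✶ _) h
    ... | t , ft≡ = t , trans (cong Ψ.f ft≡) (proj₂ (preimage u e))

    from : ∀ u s (e : Ψ.ε u ≡ s) → (∃ λ (t : Fin l) → Ψ.f (Φ.f t) ≡ u) → η u s e ≡ ✶
    from u ✶ e (t , gft≡) = Equivalence.from (Φ.ε⁻¹✶ _)
      (t , Ψ.injective (trans gft≡ (sym (proj₂ (preimage u e)))))
    from u (just k) e (t , gft≡) =
      contradiction (trans (sym e) (Equivalence.from (Ψ.ε⁻¹✶ u) (Φ.f t , gft≡))) λ ()

  lookup-punchIn : ∀ {n} (V : Conclist Act (suc n)) (i : Fin (suc n)) (t : Fin n) →
                   lookup V (punchIn i t) ≡ lookup (removeAt V i) t
  lookup-punchIn (_ ∷ _)     Fin.zero    t           = refl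
  lookup-punchIn (_ ∷ _ ∷ _) (Fin.suc i) Fin.zero    = refl
  lookup-punchIn (_ ∷ v ∷ V) (Fin.suc i) (Fin.suc t) = lookup-punchIn (v ∷ V) i t

  -- dᵢᵏ; positions are counted from 0.  Its source is determined by its
  -- target, since f omits exactly the position i and preserves labels.

  coface : ∀ {n} {V : Conclist Act (suc n)} (k : End) (i : Fin (suc n)) →
           Hom (removeAt V i) V
  coface {n} {V} k i = record
    { f         = punchIn i
    ; injective = punchIn-injective i _ _
    ; f-mono    = punchIn-mono-≤ i _ _
    ; f-label   = lookup-punchIn V i
    ; ε         = sign
    ; ε⁻¹✶      = λ u → mk⇔ (to u) (from u)
    }
    where
    sign : Fin (suc n) → Sign
    sign u with i ≟ u
    ... | yes _ = just k
    ... | no  _ = ✶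

    to : ∀ u → sign u ≡ ✶ → ∃ λ t → punchIn i t ≡ u
    to u e with i ≟ u
    to u e | no i≢u = punchOut i≢u , punchIn-punchOut i≢u

    from : ∀ u → (∃ λ t → punchIn i t ≡ u) → sign u ≡ ✶
    from u (t , it≡u) with i ≟ u
    ... | yes i≡u = contradiction (trans it≡u (sym i≡u)) (punchInᵢ≢i i t)
    ... | no  _   = refl

-- Functors □ᵒᵖ → Set.  The law map-≈ is implicit in set theory, where
-- morphisms related by _≈_ are equal.

record PrecubicalSet (Act : Set) : Set₁ where
  field
    Cells   : ∀ {n} → Conclist Act n → Set
    map     : ∀ {m n} {U : Conclist Act m} {V : Conclist Act n} →
              Hom U V → Cells V → Cells U
    map-≈   : ∀ {m n} {U : Conclist Act m} {V : Conclist Act n} {φ ψ : Hom U V} →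
              φ ≈ ψ → map φ ≗ map ψ
    map-id  : ∀ {n} {U : Conclist Act n} → map (idHom {U = U}) ≗ id
    map-∘   : ∀ {l m n} {U : Conclist Act l} {V : Conclist Act m} {W : Conclist Act n}
              (ψ : Hom V W) (φ : Hom U V) → map (ψ ⊚ φ) ≗ map φ ∘ map ψ

  δ : ∀ {n} {V : Conclist Act (suc n)} (k : End) (i : Fin (suc n)) →
      Cells V → Cells (removeAt V i)
  δ k i = map (coface k i)

record HDA (Act : Set) : Set₁ where
  field
    precubicalSet : PrecubicalSet Act
  open PrecubicalSet precubicalSet public
  field
    initial : Cells []

module _ {Act : Set} where

  record Cell (X : HDA Act) : Set where
    constructor cell
    field
      {dim}    : ℕ
      {events} : Conclist Act dim
      element  : HDA.Cells X events

  data Step (X : HDA Act) : Cell X → Cell X → Set where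
    up   : ∀ {n} {V : Conclist Act (suc n)} (i : Fin (suc n))
           {x : Cell X} {y : HDA.Cells X V} →
           x ≡ cell (HDA.δ X 𝟎 i y) → Step X x (cell y)
    down : ∀ {n} {V : Conclist Act (suc n)} (i : Fin (suc n))
           {x : HDA.Cells X V} {y : Cell X} →
           y ≡ cell (HDA.δ X 𝟏 i x) → Step X (cell x) y

  infixl 5 _▸_

  -- Path X x is the type of paths of X that end in the cell x.

  data Path (X : HDA Act) : Cell X → Set where
    ⟨⟩  : Path X (cell (HDA.initial X))
    _▸_ : ∀ {x y} → Path X x → Step X x y → Path X y

  length : ∀ {X x} → Path X x → ℕ
  length ⟨⟩      = 0
  length (α ▸ _) = suc (length α)

  infix 4 _↪_

  data _↪_ {X : HDA Act} {x : Cell X} (α : Path X x) : ∀ {y} → Path X y → Set where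
    ↪-refl : α ↪ α
    ↪-step : ∀ {y z} {β : Path X y} {φ : Step X y z} → α ↪ β → α ↪ β ▸ φ

  data Coface : Set where
    d⁰ d¹ : ℕ → Coface

  face : ∀ {X x y} → Step X x y → Coface
  face (up   i _) = d⁰ (toℕ i)
  face (down i _) = d¹ (toℕ i)

  -- A rule `P a b a′ b′` permits replacing (a , x , b) by (a′ , x′ , b′).
  -- Replace P ℓ α β: the path β is obtained from α by such a replacement
  -- around its cell x_ℓ.

  Rule : Set₁
  Rule = Coface → Coface → Coface → Coface → Set

  data Replace (P : Rule) {X : HDA Act} : ℕ → ∀ {x} → Path X x → Path X x → Set where
    here  : ∀ {w x x′ y} {α : Path X w}
            {φ : Step X w x} {ψ : Step X x y} {φ′ : Step X w x′} {ψ′ : Step X x′ y} →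
            P (face φ) (face ψ) (face φ′) (face ψ′) →
            Replace P (suc (length α)) (α ▸ φ ▸ ψ) (α ▸ φ′ ▸ ψ′)
    there : ∀ {ℓ x y} {α β : Path X x} {φ : Step X x y} →
            Replace P ℓ α β → Replace P ℓ (α ▸ φ) (β ▸ φ)

  data SimilarityRule : Rule where
    up-up     : ∀ {i j} → i < j → SimilarityRule (d⁰ i) (d⁰ j) (d⁰ (pred j)) (d⁰ i)
    down-down : ∀ {i j} → i < j → SimilarityRule (d¹ j) (d¹ i) (d¹ i) (d¹ (pred j))

  data SubsumptionRule : Rule where
    up-down₁ : ∀ {i j} → i < j → SubsumptionRule (d⁰ i) (d¹ j) (d¹ (pred j)) (d⁰ i)
    up-down₂ : ∀ {i j} → i < j → SubsumptionRule (d⁰ j) (d¹ i) (d¹ i) (d⁰ (pred j))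

  infix 4 _⇆[_]_ _⊑[_]_

  _⇆[_]_ : ∀ {X x} → Path X x → ℕ → Path X x → Set
  α ⇆[ ℓ ] β = Replace SimilarityRule ℓ α β ⊎ Replace SimilarityRule ℓ β α

  _⊑[_]_ : ∀ {X x} → Path X x → ℕ → Path X x → Set
  α ⊑[ ℓ ] β = Replace SubsumptionRule ℓ β α

  -- `start α i` is start(p) for a down-step ending event i of the last
  -- cell of α, placed directly after α.  Each replacement leaves the path
  -- before the two replaced steps unchanged, and the steps after the moving
  -- down-step play no further role, so only its current index is tracked:
  -- * past d⁰ⱼ: (d⁰ⱼ , d¹ᵢ) ↦ (d¹ᵢ , d⁰ⱼ₋₁) for i < j, and
  --   (d⁰ⱼ , d¹ᵢ) ↦ (d¹ᵢ₋₁ , d⁰ⱼ) for j < i, giving index punchOut j i;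
  -- * past d¹ⱼ: (d¹ⱼ , d¹ᵢ) ↦ (d¹ᵢ , d¹ⱼ₋₁) for i < j, and
  --   (d¹ⱼ , d¹ᵢ) ↦ (d¹ᵢ₊₁ , d¹ⱼ) for j ≤ i, giving index punchIn j i.

  start : ∀ {X x} → Path X x → Fin (Cell.dim x) → ℕ
  start ⟨⟩ ()
  start (α ▸ up j refl) i with j ≟ i
  ... | yes _   = suc (length α)
  ... | no  j≢i = start α (punchOut j≢i)
  start (α ▸ down j refl) i = start α (punchIn j i)

data STLetter (Act : Set) : Set where
  _⁺  : Act → STLetter Act
  _^_ : Act → ℕ → STLetter Act

module _ {Act : Set} where

  ST : ∀ {X : HDA Act} {x} → Path X x → List (STLetter Act)
  ST ⟨⟩                     = []
  ST (α ▸ up   {V = V} i _) = ST α ∷ʳ (lookup V i ⁺)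
  ST (α ▸ down {V = V} i _) = ST α ∷ʳ (lookup V i ^ start α i)

data Symbol : Set where
  ⊑ ⊒ ⇆ ↩ : Symbol

module _ {Act : Set} where

  PathRelation : HDA Act → HDA Act → Set₁
  PathRelation Y Z = ∀ {y z} → Path Y y → Path Z z → Set

  record IsSimulation (I : Pred Symbol 0ℓ) {Y Z : HDA Act} (R : PathRelation Y Z) : Set where
    field
      empty  : R ⟨⟩ ⟨⟩
      trace  : ∀ {y z} {α : Path Y y} {β : Path Z z} → R α β → ST α ≡ ST β
      extend : ∀ {y y′ z} {α : Path Y y} {α′ : Path Y y′} {β : Path Z z} →
               R α β → α ↪ α′ →
               ∃₂ λ z′ (β′ : Path Z z′) → β ↪ β′ × R α′ β′
      ⊑-step : ⊑ ∈ I → ∀ {y z ℓ} {α α′ : Path Y y} {β : Path Z z} →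
               R α β → α ⊑[ ℓ ] α′ →
               ∃ λ (β′ : Path Z z) → β ⊑[ ℓ ] β′ × R α′ β′
      ⊒-step : ⊒ ∈ I → ∀ {y z ℓ} {α α′ : Path Y y} {β : Path Z z} →
               R α β → α′ ⊑[ ℓ ] α →
               ∃ λ (β′ : Path Z z) → β′ ⊑[ ℓ ] β × R α′ β′
      ⇆-step : ⇆ ∈ I → ∀ {y z ℓ} {α α′ : Path Y y} {β : Path Z z} →
               R α β → α′ ⇆[ ℓ ] α →
               ∃ λ (β′ : Path Z z) → β′ ⇆[ ℓ ] β × R α′ β′
      ↩-step : ↩ ∈ I → ∀ {y y′ z} {α : Path Y y} {α′ : Path Y y′} {β : Path Z z} →
               R α β → α′ ↪ α →
               ∃₂ λ z′ (β′ : Path Z z′) → β′ ↪ β × R α′ β′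

  IsBisimulation : Pred Symbol 0ℓ → {Y Z : HDA Act} → PathRelation Y Z → Set
  IsBisimulation I {Y} {Z} R =
    IsSimulation I {Y} {Z} R × IsSimulation I {Z} {Y} (λ β α → R α β)

  Bisimilar : Pred Symbol 0ℓ → HDA Act → HDA Act → Set₁
  Bisimilar I Y Z = Σ (PathRelation Y Z) λ R → IsBisimulation I {Y} {Z} R

  _↔ST_ _↔shp_ _↔ureST_ : HDA Act → HDA Act → Set₁
  _↔ST_    = Bisimilar ∅
  _↔shp_   = Bisimilar ｛ ⊑ ｝
  _↔ureST_ = Bisimilar (｛ ⊒ ｝ ∪ ｛ ⇆ ｝ ∪ ｛ ↩ ｝)

{-# OPTIONS --safe #-}

-- A bisimulation without the clause for ⊑ cannot tell whether an event
-- started right after another one has ended could have been started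
-- earlier.  Compare the terminal HDA, with one cell per conclist, to the
-- HDA whose cells of positive dimension are in addition coloured, all
-- faces of a cell having its colour as long as they are not vertices.
-- Forgetting colours is a ureST-bisimulation: of two consecutive steps
-- only the pair (end, start) can change the colour, and no replacement
-- among ⊒ and ⇆ starts from such a pair.  The path that starts and ends a
-- red event and then starts a blue one is subsumed by no other path, since
-- a square has only one colour, but its image in the terminal HDA is.

module Submission where

open import Defs
open import Data.Bool using (Bool; true; false)
open import Data.Fin using (Fin; zero; suc; punchIn; punchOut)
open import Data.Fin.Properties using (_≟_)
open import Data.List using ([]; _∷_; _∷ʳ_)
open import Data.List.Properties using (∷ʳ-injective; ++-conicalʳ)
open import Data.Nat using (ℕ; zero; suc; z≤n; s≤s)
open import Data.Product using (_×_; ∃; ∃₂; _,_)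
open import Data.Sum as Sum using (inj₁; inj₂)
open import Data.Unit using (⊤; tt)
open import Data.Vec using ([]; _∷_)
open import Level using (0ℓ)
open import Relation.Binary.Core using (_⇒_)
open import Relation.Binary.PropositionalEquality
  using (_≡_; _≢_; refl; sym; cong; cong₂; subst)
open import Relation.Nullary using (¬_; yes; no)
open import Relation.Unary using (Pred; _⊆_; ｛_｝; _∪_)

module _ {Act : Set} where

  -- Monotonicity in the clauses, and reversal of replacement rules.

  weaken-simulation : ∀ {I J : Pred Symbol 0ℓ} {Y Z : HDA Act} {R : PathRelation Y Z} →
                      I ⊆ J → IsSimulation J {Y} {Z} R → IsSimulation I {Y} {Z} R
  weaken-simulation I⊆J S = record
    { empty  = S.empty
    ; trace  = S.trace
    ; extend = S.extend
    ; ⊑-step = λ i → S.⊑-step (I⊆J i)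
    ; ⊒-step = λ i → S.⊒-step (I⊆J i)
    ; ⇆-step = λ i → S.⇆-step (I⊆J i)
    ; ↩-step = λ i → S.↩-step (I⊆J i)
    }
    where module S = IsSimulation S

  weaken : ∀ {I J : Pred Symbol 0ℓ} → I ⊆ J → Bisimilar {Act} J ⇒ Bisimilar I
  weaken I⊆J (R , S , T) = R , weaken-simulation I⊆J S , weaken-simulation I⊆J T

  -- Since `⇆[ ℓ ]` allows its rule in both directions, reversal lets `lift-Replace` serve for both.
  converse : Rule {Act} → Rule {Act}
  converse P p q r s = P r s p q

  Replace-converse : ∀ {P : Rule {Act}} {X : HDA Act} {ℓ x} {α β : Path X x} →
                     Replace P ℓ α β → Replace (converse P) ℓ β α
  Replace-converse (here r)  = here r
  Replace-converse (there r) = there (Replace-converse r)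

  -- The terminal HDA and images of paths in it.

  terminal : HDA Act
  terminal = record
    { precubicalSet = record
      { Cells  = λ _ → ⊤
      ; map    = λ _ _ → tt
      ; map-≈  = λ _ _ → refl
      ; map-id = λ _ → refl
      ; map-∘  = λ _ _ _ → refl
      }
    ; initial = tt
    }

  module _ {X : HDA Act} where

    ! : Cell X → Cell terminal
    ! x = cell {events = Cell.events x} tt

    imageStep : ∀ {x y} → Step X x y → Step terminal (! x) (! y)
    imageStep (up i p)   = up i (cong ! p)
    imageStep (down i p) = down i (cong ! p)

    image : ∀ {x} → Path X x → Path terminal (! x)
    image ⟨⟩      = ⟨⟩
    image (α ▸ φ) = image α ▸ imageStep φ

    length-image : ∀ {x} (α : Path X x) → length (image α) ≡ length α
    length-image ⟨⟩      = refl
    length-image (α ▸ _) = cong suc (length-image α)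

    face-image : ∀ {x y} (φ : Step X x y) → face (imageStep φ) ≡ face φ
    face-image (up _ _)   = refl
    face-image (down _ _) = refl

    start-image : ∀ {x} (α : Path X x) (i : Fin (Cell.dim x)) →
                  start (image α) i ≡ start α i
    start-image ⟨⟩ ()
    start-image (α ▸ up j refl) i with j ≟ i
    ... | yes _   = cong suc (length-image α)
    ... | no  j≢i = start-image α (punchOut j≢i)
    start-image (α ▸ down j refl) i = start-image α (punchIn j i)

    ST-image : ∀ {x} (α : Path X x) → ST (image α) ≡ ST α
    ST-image ⟨⟩           = refl
    ST-image (α ▸ up _ _) = cong (_∷ʳ _) (ST-image α)
    ST-image (α ▸ down i _) =
      cong₂ (λ l k → l ∷ʳ (_ ^ k)) (ST-image α) (start-image α i)

    ↪-image : ∀ {x y} {α : Path X x} {β : Path X y} → α ↪ β → image α ↪ image β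
    ↪-image ↪-refl     = ↪-refl
    ↪-image (↪-step p) = ↪-step (↪-image p)

    Replace-image : ∀ {P : Rule {Act}} {ℓ x} {α β : Path X x} →
                    Replace P ℓ α β → Replace P ℓ (image α) (image β)
    Replace-image {P} (here {α = α} {φ} {ψ} {φ′} {ψ′} r) =
      -- `here` counts positions along `image α`, whose length agrees with that of `α` only
      -- propositionally.
      subst (λ n → Replace P (suc n) (image (α ▸ φ ▸ ψ)) (image (α ▸ φ′ ▸ ψ′)))
            (length-image α) (here r′)
      where
      r′ : P (face (imageStep φ)) (face (imageStep ψ))
             (face (imageStep φ′)) (face (imageStep ψ′))
      r′ rewrite face-image φ | face-image ψ | face-image φ′ | face-image ψ′ = r
    Replace-image (there r) = there (Replace-image r)

    data Graph : PathRelation X terminal where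
      graph : ∀ {x} (α : Path X x) → Graph α (image α)

    -- All clauses hold at once, because `image` keeps events, cofaces and positions.
    image-isSimulation : ∀ {I : Pred Symbol 0ℓ} → IsSimulation I {X} {terminal} Graph
    image-isSimulation = record
      { empty  = graph ⟨⟩
      ; trace  = λ { (graph α) → sym (ST-image α) }
      ; extend = λ { (graph _) p → _ , _ , ↪-image p , graph _ }
      ; ⊑-step = λ { _ (graph _) r → _ , Replace-image r , graph _ }
      ; ⊒-step = λ { _ (graph _) r → _ , Replace-image r , graph _ }
      ; ⇆-step = λ { _ (graph _) r → _ , Sum.map Replace-image Replace-image r , graph _ }
      ; ↩-step = λ { _ (graph _) p → _ , _ , ↪-image p , graph _ }
      }

    lift-prefix : ∀ {x z} (α : Path X x) {β : Path terminal z} → β ↪ image α →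
                  ∃₂ λ y (α′ : Path X y) → α′ ↪ α × Graph α′ β
    lift-prefix ⟨⟩      ↪-refl     = _ , _ , ↪-refl , graph _
    lift-prefix (_ ▸ _) ↪-refl     = _ , _ , ↪-refl , graph _
    lift-prefix (α ▸ φ) (↪-step p) with lift-prefix α p
    ... | _ , _ , q , g = _ , _ , ↪-step q , g

  -- The coloured HDA.

  Colour : ℕ → Set
  Colour zero    = ⊤
  Colour (suc _) = Bool

  -- The function serves to refute a positive-dimensional face of a vertex; otherwise the dimensions
  -- determine the result, so the functor laws follow by cases on them.
  recolour : ∀ m n → (Fin m → Fin n) → Colour n → Colour m
  recolour zero    _       _ _ = tt
  recolour (suc m) (suc n) _ c = c
  recolour (suc m) zero    f _ with () ← f zero

  recolour-cong : ∀ m n {f g : Fin m → Fin n} (c : Colour n) →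
                  recolour m n f c ≡ recolour m n g c
  recolour-cong zero    _       _ = refl
  recolour-cong (suc m) (suc n) _ = refl
  recolour-cong (suc m) zero {f} _ with () ← f zero

  recolour-id : ∀ n {f : Fin n → Fin n} (c : Colour n) → recolour n n f c ≡ c
  recolour-id zero    _ = refl
  recolour-id (suc n) _ = refl

  recolour-∘ : ∀ l m n {h : Fin l → Fin n} {f : Fin l → Fin m} {g : Fin m → Fin n} (c : Colour n) →
               recolour l n h c ≡ recolour l m f (recolour m n g c)
  recolour-∘ zero    _       _       _ = refl
  recolour-∘ (suc _) (suc _) (suc _) _ = refl
  recolour-∘ (suc _) (suc _) zero {g = g} _ with () ← g zero
  recolour-∘ (suc _) zero    _    {f = f} _ with () ← f zero

  coloured : HDA Act
  coloured = record
    { precubicalSet = record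
      { Cells  = λ {n} _ → Colour n
      ; map    = λ {m} {n} φ → recolour m n (Hom.f φ)
      ; map-≈  = λ {m} {n} _ → recolour-cong m n
      ; map-id = λ {n} → recolour-id n
      ; map-∘  = λ {l} {m} {n} _ _ → recolour-∘ l m n
      }
    ; initial = tt
    }

  -- Lifting paths and replacements from the terminal HDA.

  -- Vertices have every tint, so that they fit between cells of any colour.
  data Tinted (c : Bool) : Cell coloured → Set where
    vertex : ∀ {U} → Tinted c (cell {dim = zero} {U} tt)
    tinted : ∀ {n U} → Tinted c (cell {dim = suc n} {U} c)

  tint : ∀ x → ∃ λ c → Tinted c x
  tint (cell {zero}  _) = true , vertex
  tint (cell {suc _} c) = c , tinted

  paint : ∀ c z → ∃ λ x → Tinted c x × ! x ≡ z
  paint c (cell {zero}  _) = cell tt , vertex , refl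
  paint c (cell {suc _} _) = cell c , tinted , refl

  -- Within one tint the face equation is automatic: a face of a cell coloured `c` is a vertex or
  -- again coloured `c`.
  liftStep : ∀ {c x y} → Tinted c x → Tinted c y → (φ : Step terminal (! x) (! y)) →
             ∃ λ (ψ : Step coloured x y) → imageStep ψ ≡ φ
  liftStep vertex tinted (up i refl)   = up i refl , refl
  liftStep tinted tinted (up i refl)   = up i refl , refl
  liftStep tinted vertex (down i refl) = down i refl , refl
  liftStep tinted tinted (down i refl) = down i refl , refl

  lift-extension : ∀ {x z} (α : Path coloured x) {β : Path terminal z} → image α ↪ β →
                   ∃₂ λ y (α′ : Path coloured y) → α ↪ α′ × Graph α′ β
  lift-extension α ↪-refl = _ , α , ↪-refl , graph α
  lift-extension α (↪-step {z = z} {φ = φ} p) with lift-extension α p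
  -- The new cell gets the tint of the last one, by default `true` after a vertex.
  ... | x , _ , q , graph α′ with tint x
  ... | c , t with paint c z
  ... | y , u , refl with liftStep t u φ
  ... | ψ , refl = _ , _ , ↪-step q , graph (α′ ▸ ψ)

  tinted-source : ∀ {n U w c} → Step coloured w (cell {dim = suc n} {U} c) → Tinted c w
  tinted-source (up   {zero}  _ refl) = vertex
  tinted-source (up   {suc _} _ refl) = tinted
  tinted-source (down _ refl) = tinted

  tinted-target : ∀ {n U y c} → Step coloured (cell {dim = suc n} {U} c) y → Tinted c y
  tinted-target (up _ refl) = tinted
  tinted-target (down {zero}  _ refl) = vertex
  tinted-target (down {suc _} _ refl) = tinted

  AvoidsEndStart : Rule {Act} → Set
  AvoidsEndStart P = ∀ {i j r s} → ¬ P (d¹ i) (d⁰ j) r s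

  -- A middle cell of positive dimension passes its colour to both neighbours. A vertex is entered
  -- only by an end and left only by a start, the excluded pair.
  common-tint : ∀ {P r s w x y} → AvoidsEndStart P →
                (φ : Step coloured w x) (ψ : Step coloured x y) → P (face φ) (face ψ) r s →
                ∃ λ c → Tinted c w × Tinted c y
  common-tint {x = cell {suc _} c} _     φ          ψ        _ = c , tinted-source φ , tinted-target ψ
  common-tint {x = cell {zero}  _} avoid (down _ _) (up _ _) r with () ← avoid r

  -- The outer cells share a tint; painting the new middle cell in it lets both new steps lift.
  lift-Replace : ∀ {P : Rule {Act}} → AvoidsEndStart P →
                 ∀ {ℓ x} (α : Path coloured x) {β : Path terminal (! x)} →
                 Replace P ℓ (image α) β →
                 ∃ λ (α′ : Path coloured x) → Replace P ℓ α α′ × Graph α′ β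
  lift-Replace {P} avoid (α ▸ φ ▸ ψ) (here {x′ = z} {φ′ = φ″} {ψ″} r)
    rewrite face-image φ | face-image ψ with common-tint {P} avoid φ ψ r
  ... | c , t , u with paint c z
  ... | v , t′ , refl with liftStep t t′ φ″ | liftStep t′ u ψ″
  ... | φ′ , refl | ψ′ , refl rewrite face-image φ′ | face-image ψ′ =
    α ▸ φ′ ▸ ψ′ , subst (λ n → Replace P (suc n) _ _) (sym (length-image α)) (here r) , graph _
  lift-Replace avoid (α ▸ φ ▸ ψ) (there r) with lift-Replace avoid (α ▸ φ) r
  ... | _ , r′ , graph α′ = _ , there r′ , graph (α′ ▸ ψ)
  lift-Replace avoid (⟨⟩ ▸ φ) (there ())

  ureST : Pred Symbol 0ℓ
  ureST = ｛ ⊒ ｝ ∪ ｛ ⇆ ｝ ∪ ｛ ↩ ｝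

  lift-isSimulation : IsSimulation ureST {terminal} {coloured} (λ β α → Graph α β)
  lift-isSimulation = record
    { empty  = graph ⟨⟩
    ; trace  = λ { (graph α) → ST-image α }
    ; extend = λ { (graph α) → lift-extension α }
    ; ⊑-step = λ { (inj₁ ()) ; (inj₂ (inj₁ ())) ; (inj₂ (inj₂ ())) }
    ; ⊒-step = λ { _ (graph α) → lift-Replace (λ ()) α }
    ; ⇆-step = λ { _ (graph α) → ⇆-step α }
    ; ↩-step = λ { _ (graph α) → lift-prefix α }
    }
    where
    ⇆-step : ∀ {x ℓ} (α : Path coloured x) {β : Path terminal (! x)} →
             β ⇆[ ℓ ] image α → ∃ λ (α′ : Path coloured x) → α′ ⇆[ ℓ ] α × Graph α′ β
    ⇆-step α (inj₁ r) with lift-Replace (λ ()) α (Replace-converse r)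
    ... | α′ , r′ , g = α′ , inj₁ (Replace-converse r′) , g
    ⇆-step α (inj₂ r) with lift-Replace (λ ()) α r
    ... | α′ , r′ , g = α′ , inj₂ r′ , g

  coloured-ureST-terminal : coloured ↔ureST terminal
  coloured-ureST-terminal = Graph , image-isSimulation , lift-isSimulation

  -- A path that separates the two HDAs under shp.

  -- The colours red and blue are true and false.

  red-blue : ∀ a → Path coloured (cell {events = a ∷ []} false)
  red-blue a = ⟨⟩ ▸ up {V = a ∷ []} zero {y = true} refl ▸ down zero refl ▸ up zero refl

  -- Only the last two steps are an end followed by a start. Undoing a replacement there would join
  -- the red edge to the blue one by a start and an end, against `common-tint`.
  red-blue-unsubsumed : ∀ a {ℓ α} → ¬ red-blue a ⊑[ ℓ ] α
  red-blue-unsubsumed a (here {φ = φ} {ψ} r)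
    with common-tint {SubsumptionRule} (λ ()) φ ψ r
  ... | _ , tinted , ()
  red-blue-unsubsumed a (there (here ()))
  red-blue-unsubsumed a (there (there (there ())))

  -- Only the kind of step is compared; where this is used, dimensions at most one force the index.
  data Agree : STLetter Act → Coface {Act} → Set where
    starts : ∀ {a i} → Agree (a ⁺) (d⁰ i)
    ends   : ∀ {a k i} → Agree (a ^ k) (d¹ i)

  ST-last : ∀ {X : HDA Act} {x} (α : Path X x) {τ l} → ST α ≡ τ ∷ʳ l →
            ∃ λ w → ∃₂ λ (β : Path X w) (φ : Step X w x) →
            α ≡ β ▸ φ × ST β ≡ τ × Agree l (face φ)
  ST-last ⟨⟩ {τ} eq with () ← ++-conicalʳ τ _ (sym eq)
  ST-last (α ▸ up i p) {τ} eq with refl , refl ← ∷ʳ-injective (ST α) τ eq =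
    _ , α , up i p , refl , refl , starts
  ST-last (α ▸ down i p) {τ} eq with refl , refl ← ∷ʳ-injective (ST α) τ eq =
    _ , α , down i p , refl , refl , ends

  -- Phrased by `length`, since `α ≡ ⟨⟩` is ill-typed for an arbitrary end cell `x`.
  ST-empty : ∀ {X : HDA Act} {x} (α : Path X x) → ST α ≡ [] → length α ≡ 0
  ST-empty ⟨⟩           _  = refl
  ST-empty (α ▸ up _ _)   eq with () ← ++-conicalʳ (ST α) _ eq
  ST-empty (α ▸ down _ _) eq with () ← ++-conicalʳ (ST α) _ eq

  start-end-start-subsumed :
    ∀ {w x y z} (α : Path terminal w) → length α ≡ 0 →
    (φ : Step terminal w x) (ψ : Step terminal x y) (χ : Step terminal y z) →
    ∀ {a b c k} → Agree (a ⁺) (face φ) → Agree (b ^ k) (face ψ) → Agree (c ⁺) (face χ) →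
    ∃₂ λ ℓ β → α ▸ φ ▸ ψ ▸ χ ⊑[ ℓ ] β
  start-end-start-subsumed ⟨⟩ _
    (up {V = v ∷ []} zero refl) (down zero refl) (up {V = w ∷ []} zero refl) _ _ _ =
    -- The square on `v` and `w` exists in the terminal HDA: `w` starts at index 1 while `v` still
    -- runs, and ending `v` leaves `w`.
    2 ,
    ⟨⟩ ▸ up {V = v ∷ []} zero refl ▸ up {V = v ∷ w ∷ []} (suc zero) refl ▸ down zero refl ,
    here (up-down₂ (s≤s z≤n))

  subsumed : ∀ {a b c k z} (β : Path terminal z) → ST β ≡ a ⁺ ∷ b ^ k ∷ c ⁺ ∷ [] →
             ∃₂ λ ℓ β′ → β ⊑[ ℓ ] β′
  subsumed {a} {b} {k = k} β eq with ST-last β {a ⁺ ∷ b ^ k ∷ []} eq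
  ... | _ , γ , χ , refl , eq₂ , r with ST-last γ {a ⁺ ∷ []} eq₂
  ... | _ , α , ψ , refl , eq₁ , q with ST-last α {[]} eq₁
  ... | _ , ε , φ , refl , eq₀ , p =
    start-end-start-subsumed ε (ST-empty ε eq₀) φ ψ χ p q r

  -- Whatever path answers `red-blue a` has its trace, hence is subsumed by another path; the ⊑
  -- clause would carry this back to `red-blue a`.
  coloured-not-shp-terminal : Act → ¬ coloured ↔shp terminal
  coloured-not-shp-terminal a (_ , S , T) =
    let _ , β , _ , r = S.extend S.empty (↪-step {φ = up zero refl} (↪-step (↪-step ↪-refl)))
        _ , _ , p     = subsumed β (sym (S.trace {α = red-blue a} r))
        _ , q , _     = T.⊑-step refl r p
    in red-blue-unsubsumed a q
    where
    module S = IsSimulation S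
    module T = IsSimulation T

theorem5p7 : (Act : Set) (a b c d : Act) →
    a ≢ b → a ≢ c → a ≢ d → b ≢ c → b ≢ d → c ≢ d →
    (_↔shp_ {Act} ⇒ _↔ST_ {Act}) ×
    (∃₂ λ (Y Z : HDA Act) → (Y ↔ST Z) × ¬ (Y ↔shp Z)) ×
    (∃₂ λ (Y Z : HDA Act) → (Y ↔ureST Z) × ¬ (Y ↔shp Z))
theorem5p7 Act a _ _ _ _ _ _ _ _ _ =
  weaken (λ ()) ,
  (coloured , terminal , weaken (λ ()) coloured-ureST-terminal , coloured-not-shp-terminal a) ,
  (coloured , terminal , coloured-ureST-terminal , coloured-not-shp-terminal a)
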